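{- Let $r \geq 0$ and $n \geq 0$ be integers and let $a,b,x$ be indeterminates. Then $$\prod_{i=0}^{n-1}\bigl(x+(a+b)r+ai\bigr)=\sum_{k=0}^n \mathcal{G}_{a,b}(n,k;r)\prod_{i=0}^{k-1}(x-bi).$$
   Context: Write $[m]=\{1,\ldots,m\}$, $[0]=\varnothing$. A Lah distribution of $[m]$ into $\ell$ blocks is a partition of $[m]$ into $\ell$ non-empty, pairwise disjoint blocks in which the elements within each block are linearly ordered (the blocks themselves are not ordered). For integers $n,k,r$ with $0\le k\le n$ and $r\ge 0$, let $\mathcal{L}_r(n,k)$ be the set of Lah distributions of $[n+r]$ into $k+r$ blocks in which the elements of $[r]$ belong to distinct blocks. An element $i$ of a Lah distribution $\lambda$ is a record low if there is no element $j<i$ to the left of $i$ within its block. Let $rec^*(\lambda)$ be the number of record lows of $\lambda$ that are not the smallest element of their block, and let $nrec(\lambda)$ be the number of elements of the underlying set that are not record lows of $\lambda$. The generalized $r$-Lah number is the polynomial in indeterminates $a,b$ $$\mathcal{G}_{a,b}(n,k;r)=\sum_{\lambda\in\mathcal{L}_r(n,k)}a^{nrec(\lambda)}b^{rec^*(\lambda)},$$ with $\mathcal{G}_{a,b}(n,k;r)=0$ unless $0\le k\le n$ and $r\ge 0$. Empty sums are $0$ and empty products are $1$. -}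

module Defs where

open import Algebra.Bundles using (CommutativeRing)
import Algebra.Properties.Semiring.Exp as SemiringExp
import Algebra.Properties.Semiring.Mult as SemiringMult
open import Data.List.Base
  using (List; []; _∷_; _++_; applyUpTo; cartesianProductWith; concat; concatMap;
         filter; foldr; length; map; upTo)
open import Data.List.Membership.DecPropositional using (_∈?_)
open import Data.List.Membership.Propositional using (_∈_)
open import Data.List.Membership.Propositional.Properties
  using (∈-cartesianProductWith⁺; ∈-cartesianProductWith⁻; ∈-concat⁺′; ∈-filter⁺; ∈-filter⁻; ∈-map⁺; ∈-upTo⁺)
open import Data.List.Membership.Propositional.Properties.WithK using (unique∧set⇒bag)
open import Data.List.Properties using (≡-dec; length-++; ∷-injective)
open import Data.List.Relation.Binary.BagAndSetEquality using (∼bag⇒↭)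
open import Data.List.Relation.Binary.Disjoint.Propositional using (Disjoint)
open import Data.List.Relation.Binary.Permutation.Propositional using (_↭_; ↭-sym; ↭⇒↭ₛ)
open import Data.List.Relation.Binary.Permutation.Propositional.Properties using (∈-resp-↭; ↭-length)
import Data.List.Relation.Binary.Permutation.Setoid.Properties as ↭ₛ
open import Data.List.Relation.Unary.All as All using (All; []; _∷_; all?)
import Data.List.Relation.Unary.All.Properties as All
open import Data.List.Relation.Unary.AllPairs as AllPairs using (AllPairs; []; _∷_; allPairs?)
import Data.List.Relation.Unary.AllPairs.Properties as AllPairs
open import Data.List.Relation.Unary.Any using (Any; any?; here; there)
open import Data.List.Relation.Unary.Unique.DecPropositional using (unique?)
open import Data.List.Relation.Unary.Unique.Propositional using (Unique)
import Data.List.Relation.Unary.Unique.Propositional.Properties as Unique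
open import Data.Nat.Base using (ℕ; zero; suc; _+_; _≤_; _<_; s≤s)
open import Data.Nat.Properties
  using (_≟_; _≤?_; _<?_; <⇒≢; suc-injective; m≤m+n; m≤n+m; ≤-trans; ≤-reflexive)
open import Data.Product.Base using (_×_; _,_; proj₁; proj₂)
open import Function.Base using (_∘_)
open import Function.Bundles using (_⇔_; mk⇔)
open import Relation.Binary.PropositionalEquality
  using (_≡_; _≢_; refl; sym; trans; cong; subst; setoid)
open import Relation.Nullary using (¬_; Dec; map′; _×-dec_; ¬?)
open import Relation.Unary using (Decidable)

-- [m] = {1, …, m}
[1⋯_] : ℕ → List ℕ
[1⋯ m ] = applyUpTo suc m

-- A block, read from left to right.
Block : Set
Block = List ℕ

-- min B < min C, for non-empty blocks B and C.
_minLess_ : Block → Block → Set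
B minLess C = Any (λ i → All (i <_) C) B

-- The blocks of a Lah distribution form an unordered collection; each such
-- collection is represented by the one list that displays its blocks by
-- increasing smallest element.
record IsLahDistribution (m ℓ : ℕ) (d : List Block) : Set where
  constructor isLah
  field
    blockCount : length d ≡ ℓ
    nonEmpty   : All (_≢ []) d
    partition  : concat d ↭ [1⋯ m ]
    canonical  : AllPairs _minLess_ d

-- The elements of [r] belong to distinct blocks: no two entries of a block are
-- both in [r] (all entries being positive).
Separates : ℕ → List Block → Set
Separates r d = All (AllPairs (λ i j → ¬ (i ≤ r × j ≤ r))) d

-- d ∈ 𝓛ᵣ(n,k)
IsRLah : (r n k : ℕ) → List Block → Set
IsRLah r n k d = IsLahDistribution (n + r) (k + r) d × Separates r d

-- An occurrence (before , i , after) of i in the block before ++ i ∷ after.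
Occurrence : Set
Occurrence = Block × ℕ × Block

occurrences : Block → List Occurrence
occurrences []      = []
occurrences (i ∷ B) = ([] , i , B) ∷ map (λ (before , j , after) → i ∷ before , j , after) (occurrences B)

RecordLow : Occurrence → Set
RecordLow (before , i , after) = ¬ Any (_< i) before

Smallest : Occurrence → Set
Smallest (before , i , after) = All (i ≤_) (before ++ i ∷ after)

recordLow? : Decidable RecordLow
recordLow? (before , i , after) = ¬? (any? (_<? i) before)

smallest? : Decidable Smallest
smallest? (before , i , after) = all? (i ≤?_) (before ++ i ∷ after)

rec* : List Block → ℕ
rec* d = length (filter (λ o → recordLow? o ×-dec ¬? (smallest? o)) (concatMap occurrences d))

nrec : List Block → ℕ
nrec d = length (filter (¬? ∘ recordLow?) (concatMap occurrences d))

[1⋯]-unique : ∀ m → Unique [1⋯ m ]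
[1⋯]-unique m = Unique.applyUpTo⁺₁ suc m (λ i<j _ → <⇒≢ i<j ∘ suc-injective)

↭[1⋯]? : ∀ m xs → Dec (xs ↭ [1⋯ m ])
↭[1⋯]? m xs = map′ to from
  (unique? _≟_ xs ×-dec all? (λ i → _∈?_ _≟_ i [1⋯ m ]) xs ×-dec all? (λ i → _∈?_ _≟_ i xs) [1⋯ m ])
  where
  to : Unique xs × All (_∈ [1⋯ m ]) xs × All (_∈ xs) [1⋯ m ] → xs ↭ [1⋯ m ]
  to (u , ⊆ , ⊇) = ∼bag⇒↭ (unique∧set⇒bag u ([1⋯]-unique m) (mk⇔ (All.lookup ⊆) (All.lookup ⊇)))

  from : xs ↭ [1⋯ m ] → Unique xs × All (_∈ [1⋯ m ]) xs × All (_∈ xs) [1⋯ m ]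
  from p = ↭ₛ.Unique-resp-↭ (setoid ℕ) (↭⇒↭ₛ (↭-sym p)) ([1⋯]-unique m)
         , All.tabulate (∈-resp-↭ p)
         , All.tabulate (∈-resp-↭ (↭-sym p))

isLahDistribution? : ∀ m ℓ → Decidable (IsLahDistribution m ℓ)
isLahDistribution? m ℓ d = map′
  (λ (c , e , p , o) → isLah c e p o)
  (λ (isLah c e p o) → c , e , p , o)
  ( (length d ≟ ℓ)
  ×-dec all? (λ B → ¬? (≡-dec _≟_ B [])) d
  ×-dec ↭[1⋯]? m (concat d)
  ×-dec allPairs? (λ B C → any? (λ i → all? (i <?_) C) B) d )

isRLah? : ∀ r n k → Decidable (IsRLah r n k)
isRLah? r n k d =
  isLahDistribution? (n + r) (k + r) d
  ×-dec all? (allPairs? (λ i j → ¬? ((i ≤? r) ×-dec (j ≤? r)))) d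

tuples : {A : Set} → ℕ → List A → List (List A)
tuples zero    xs = [] ∷ []
tuples (suc j) xs = cartesianProductWith _∷_ xs (tuples j xs)

words : ℕ → List Block
words m = concat (map (λ j → tuples j [1⋯ m ]) (upTo (suc m)))

-- 𝓛ᵣ(n,k), selected from all lists of k + r words of length at most n + r over
-- [n + r]; ∈-𝓛 and 𝓛-unique show that each element is listed exactly once.
𝓛 : (r n k : ℕ) → List (List Block)
𝓛 r n k = filter (isRLah? r n k) (tuples (k + r) (words (n + r)))

private
  ∈-tuples⁺ : ∀ {A : Set} {xs ys : List A} → All (_∈ xs) ys → ys ∈ tuples (length ys) xs
  ∈-tuples⁺ []       = here refl
  ∈-tuples⁺ (p ∷ ps) = ∈-cartesianProductWith⁺ _∷_ p (∈-tuples⁺ ps)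

  ∈-tuples⇒length : ∀ {A : Set} j (xs : List A) {ys} → ys ∈ tuples j xs → length ys ≡ j
  ∈-tuples⇒length zero    xs (here refl) = refl
  ∈-tuples⇒length (suc j) xs p with ∈-cartesianProductWith⁻ _∷_ xs (tuples j xs) p
  ... | _ , _ , _ , q , refl = cong suc (∈-tuples⇒length j xs q)

  tuples-unique : ∀ {A : Set} j {xs : List A} → Unique xs → Unique (tuples j xs)
  tuples-unique zero    u = [] ∷ []
  tuples-unique (suc j) u = Unique.cartesianProductWith⁺ _∷_ ∷-injective u (tuples-unique j u)

  words-unique : ∀ m → Unique (words m)
  words-unique m = Unique.concat⁺
    (All.map⁺ (All.universal (λ j → tuples-unique j ([1⋯]-unique m)) (upTo (suc m))))
    (AllPairs.map⁺ (AllPairs.map disjoint (Unique.upTo⁺ (suc m))))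
    where
    disjoint : ∀ {i j} → i ≢ j → Disjoint (tuples i [1⋯ m ]) (tuples j [1⋯ m ])
    disjoint {i} {j} i≢j (p , q) = i≢j (trans (sym (∈-tuples⇒length i _ p)) (∈-tuples⇒length j _ q))

  length≤concat : ∀ {B : Block} {d} → B ∈ d → length B ≤ length (concat d)
  length≤concat {d = B ∷ d} (here refl) =
    ≤-trans (m≤m+n _ _) (≤-reflexive (sym (length-++ B)))
  length≤concat {d = B ∷ d} (there p) =
    ≤-trans (length≤concat p) (≤-trans (m≤n+m _ (length B)) (≤-reflexive (sym (length-++ B))))

  length-[1⋯] : ∀ (f : ℕ → ℕ) m → length (applyUpTo f m) ≡ m
  length-[1⋯] f zero    = refl
  length-[1⋯] f (suc m) = cong suc (length-[1⋯] (f ∘ suc) m)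

  ∈-words⁺ : ∀ {m ℓ d B} → IsLahDistribution m ℓ d → B ∈ d → B ∈ words m
  ∈-words⁺ {m} {B = B} L B∈d = ∈-concat⁺′
    (∈-tuples⁺ (All.tabulate (λ i∈B → ∈-resp-↭ partition (∈-concat⁺′ i∈B B∈d))))
    (∈-map⁺ (λ j → tuples j [1⋯ m ]) (∈-upTo⁺ (s≤s (≤-trans (length≤concat B∈d)
      (≤-reflexive (trans (↭-length partition) (length-[1⋯] suc m)))))))
    where open IsLahDistribution L

∈-𝓛 : ∀ {r n k d} → d ∈ 𝓛 r n k ⇔ IsRLah r n k d
∈-𝓛 {r} {n} {k} {d} = mk⇔
  (proj₂ ∘ ∈-filter⁻ (isRLah? r n k) {xs = tuples (k + r) (words (n + r))})
  (λ L → ∈-filter⁺ (isRLah? r n k)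
    (subst (λ ℓ → d ∈ tuples ℓ (words (n + r))) (IsLahDistribution.blockCount (proj₁ L))
      (∈-tuples⁺ (All.tabulate (∈-words⁺ (proj₁ L)))))
    L)

𝓛-unique : ∀ r n k → Unique (𝓛 r n k)
𝓛-unique r n k = Unique.filter⁺ (isRLah? r n k) (tuples-unique (k + r) (words-unique (n + r)))

module RLahNumbers {c ℓ} (R : CommutativeRing c ℓ) where
  open CommutativeRing R using (Carrier; 0#; 1#; semiring)
    renaming (_+_ to _⊕_; _*_ to _⊗_)

  open SemiringExp semiring public using (_^_)
  open SemiringMult semiring public using () renaming (_×_ to _·_)

  ∑ ∏ : {A : Set} → List A → (A → Carrier) → Carrier
  ∑ xs f = foldr _⊕_ 0# (map f xs)
  ∏ xs f = foldr _⊗_ 1# (map f xs)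

  infix 8 ∑ ∏
  syntax ∑ xs (λ i → e) = ∑[ i ← xs ] e
  syntax ∏ xs (λ i → e) = ∏[ i ← xs ] e

  𝓖 : (a b : Carrier) (n k r : ℕ) → Carrier
  𝓖 a b n k r = ∑[ d ← 𝓛 r n k ] ((a ^ nrec d) ⊗ (b ^ rec* d))

{-# OPTIONS --safe #-}

-- Delete the largest element of a distribution in 𝓛ᵣ(n+1,k).  If it was a block
-- on its own, that block was the last one and the weight is unchanged; otherwise it
-- stood at the front of one of the k + r blocks (a record low that is not minimal,
-- a factor b) or behind one of the n + r other elements (not a record low, a factor
-- a), and the status of the other elements never depends on it.  Hence
--   𝓖(n+1,k) = 𝓖(n,k-1) + ((n + r) a + (k + r) b) 𝓖(n,k),
-- and since (n + r) a + (k + r) b + (x - k b) = x + r (a + b) + n a, passing from n to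
-- n + 1 multiplies the right-hand side by the next factor of the product on the left.
module Submission where

open import Defs
open import Algebra.Bundles using (CommutativeRing)
import Algebra.Properties.CommutativeMonoid.Mult as CommutativeMonoidMult
import Algebra.Properties.Semiring.Exp as SemiringExp
import Algebra.Properties.Semiring.Mult as SemiringMult
import Algebra.Solver.Ring.NaturalCoefficients.Default as Solver
open import Data.List.Base
  using (List; []; _∷_; [_]; _++_; _∷ʳ_; applyUpTo; concat; concatMap; filter; foldr; length; map; upTo)
open import Data.List.Properties
open import Data.List.Membership.Propositional using (_∈_; find)
open import Data.List.Membership.Propositional.Properties
open import Data.List.Membership.Propositional.Properties.WithK using (unique∧set⇒bag)
open import Data.List.Relation.Binary.BagAndSetEquality using (∼bag⇒↭)
open import Data.List.Relation.Binary.Pointwise using (Pointwise-≡⇒≡)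
open import Data.List.Relation.Binary.Permutation.Propositional
  using (_↭_; prep; ↭-refl; ↭-sym; ↭-trans; ↭-reflexive; ↭⇒↭ₛ)
open import Data.List.Relation.Binary.Permutation.Propositional.Properties
  using (All-resp-↭; Any-resp-↭; ∈-resp-↭; ↭-length; filter-↭; ++⁺ˡ; ++⁺ʳ; shift; drop-∷; ++-comm)
import Data.List.Relation.Binary.Permutation.Setoid.Properties as ↭ₛ
open import Data.List.Relation.Unary.All as All using (All; []; _∷_)
import Data.List.Relation.Unary.All.Properties as All
open import Data.List.Relation.Unary.AllPairs as AllPairs using (AllPairs; []; _∷_)
import Data.List.Relation.Unary.AllPairs.Properties as AllPairs
open import Data.List.Relation.Unary.Any as Any using (Any; here; there)
open import Data.List.Relation.Unary.Linked.Properties using (AllPairs⇒Linked)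
open import Data.List.Relation.Unary.Sorted.TotalOrder.Properties using (↗↭↗⇒≋)
open import Data.List.Relation.Unary.Unique.Propositional using (Unique)
import Data.List.Relation.Unary.Unique.Propositional.Properties as Unique
open import Data.Nat.Base using (ℕ; zero; suc; _≤_; _<_; z≤n; s≤s; s<s) renaming (_+_ to _+ℕ_)
open import Data.Nat.Properties
  using (_≟_; _≤?_; <-asym; <⇒≱; <⇒≤; <⇒≢; ≤-refl; ≤-trans; ≤-reflexive; ≤-totalOrder; m<1+n⇒m≤n;
         m≤n+m; 1+n≢n; 1+n≰n; +-mono-≤; +-commutativeSemigroup; module ≤-Reasoning)
open import Data.Product.Base using (∃; _×_; _,_; proj₁; proj₂)
open import Data.Sum.Base using (_⊎_; inj₁; inj₂)
open import Function.Base using (_∘_; id; case_of_)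
open import Function.Bundles using (_⇔_; mk⇔; Equivalence)
open import Level using (0ℓ)
open import Relation.Binary.PropositionalEquality
  using (_≡_; _≢_; refl; sym; trans; cong; cong₂; subst; resp₂; module ≡-Reasoning)
  renaming (setoid to ≡-setoid)
open import Relation.Nullary using (¬_; yes; no; contradiction; ¬?; _×-dec_)
open import Relation.Unary using (Pred; Decidable)

open Equivalence using (to; from)

-- Duplicate-free lists and the list [1⋯ m ]

unique∧set⇒↭ : ∀ {A : Set} {xs ys : List A} → Unique xs → Unique ys →
               (∀ {z} → z ∈ xs ⇔ z ∈ ys) → xs ↭ ys
unique∧set⇒↭ xs! ys! eq = ∼bag⇒↭ (unique∧set⇒bag xs! ys! eq)

-- Every entry of `f x` determines `x` through `g`, so the lists of two different indices cannot
-- share an entry.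
concatMap-unique : ∀ {A B : Set} (f : A → List B) (g : B → A) {xs} → Unique xs →
                   (∀ {x} → x ∈ xs → Unique (f x)) →
                   (∀ {x y} → x ∈ xs → y ∈ f x → g y ≡ x) →
                   Unique (concatMap f xs)
concatMap-unique f g []            f! gf = []
concatMap-unique f g xs!@(_ ∷ tl!) f! gf =
  Unique.++⁺ (f! (here refl)) (concatMap-unique f g tl! (f! ∘ there) (gf ∘ there))
    λ (p , q) → let x′ , x′∈ , y∈ = find (∈-concatMap⁻ f q) in
      Unique.Unique[x∷xs]⇒x∉xs xs!
        (subst (_∈ _) (trans (sym (gf (there x′∈) y∈)) (gf (here refl) p)) x′∈)

[1⋯]-∷ʳ : ∀ N → [1⋯ suc N ] ↭ suc N ∷ [1⋯ N ]
[1⋯]-∷ʳ N = ↭-trans (↭-reflexive (sym (applyUpTo-∷ʳ suc N))) (++-comm [1⋯ N ] [ suc N ])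

[1⋯]-bound : ∀ N → All (_≤ N) [1⋯ N ]
[1⋯]-bound N = All.applyUpTo⁺₁ suc N id

-- Insertion of a new largest element

-- A derivation is a position for `m`: each `past` skips one entry, and the position behind the last
-- entry is `front` for the empty remainder.
data Insertion (m : ℕ) : Block → Block → Set where
  front : ∀ {B} → Insertion m B (m ∷ B)
  past  : ∀ {i B B′} → Insertion m B B′ → Insertion m (i ∷ B) (i ∷ B′)

data BlockInsertion (m : ℕ) : List Block → List Block → Set where
  into : ∀ {B B′ d} → Insertion m B B′ → BlockInsertion m (B ∷ d) (B′ ∷ d)
  past : ∀ {B d d′} → BlockInsertion m d d′ → BlockInsertion m (B ∷ d) (B ∷ d′)

insertions : ℕ → Block → List Block
insertions m []      = [ [ m ] ]
insertions m (i ∷ B) = (m ∷ i ∷ B) ∷ map (i ∷_) (insertions m B)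

blockInsertions : ℕ → List Block → List (List Block)
blockInsertions m []      = []
blockInsertions m (B ∷ d) = map (_∷ d) (insertions m B) ++ map (B ∷_) (blockInsertions m d)

Below : ℕ → List Block → Set
Below m = All (All (_< m))

private variable
  m N ℓ r : ℕ
  B B′ C C′ : Block
  d d′ : List Block
  o o′ : Occurrence

∈-insertions⁺ : Insertion m B B′ → B′ ∈ insertions m B
∈-insertions⁺ {B = []}    front    = here refl
∈-insertions⁺ {B = _ ∷ _} front    = here refl
∈-insertions⁺             (past p) = there (∈-map⁺ _ (∈-insertions⁺ p))

∈-insertions⁻ : ∀ B → B′ ∈ insertions m B → Insertion m B B′
∈-insertions⁻ []      (here refl) = front
∈-insertions⁻ (_ ∷ _) (here refl) = front
∈-insertions⁻ (_ ∷ B) (there q) with ∈-map⁻ _ q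
... | _ , q′ , refl = past (∈-insertions⁻ B q′)

length-insertions : ∀ m B → length (insertions m B) ≡ suc (length B)
length-insertions m []      = refl
length-insertions m (i ∷ B) =
  cong suc (trans (length-map (i ∷_) (insertions m B)) (length-insertions m B))

∈-blockInsertions⁺ : BlockInsertion m d d′ → d′ ∈ blockInsertions m d
∈-blockInsertions⁺ (into p) = ∈-++⁺ˡ (∈-map⁺ _ (∈-insertions⁺ p))
∈-blockInsertions⁺ (past p) = ∈-++⁺ʳ _ (∈-map⁺ _ (∈-blockInsertions⁺ p))

∈-blockInsertions⁻ : ∀ d → d′ ∈ blockInsertions m d → BlockInsertion m d d′
∈-blockInsertions⁻ {m = m} (B ∷ d) q with ∈-++⁻ (map (_∷ d) (insertions m B)) q
... | inj₁ q′ with ∈-map⁻ _ q′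
...   | _ , q″ , refl = into (∈-insertions⁻ B q″)
∈-blockInsertions⁻ (B ∷ d) q | inj₂ q′ with ∈-map⁻ _ q′
...   | _ , q″ , refl = past (∈-blockInsertions⁻ d q″)

insertion-↭ : Insertion m B B′ → B′ ↭ m ∷ B
insertion-↭ front    = ↭-refl
insertion-↭ {m} (past {i} {B} p) = ↭-trans (prep i (insertion-↭ p)) (shift m [ i ] B)

blockInsertion-↭ : BlockInsertion m d d′ → concat d′ ↭ m ∷ concat d
blockInsertion-↭ (into {d = d} p) = ++⁺ʳ (concat d) (insertion-↭ p)
blockInsertion-↭ {m} (past {B} {d} p) =
  ↭-trans (++⁺ˡ B (blockInsertion-↭ p)) (shift m B (concat d))

blockInsertion-length : BlockInsertion m d d′ → length d′ ≡ length d
blockInsertion-length (into _) = refl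
blockInsertion-length (past p) = cong suc (blockInsertion-length p)

insertion-nonEmpty : Insertion m B B′ → B′ ≢ []
insertion-nonEmpty front    ()
insertion-nonEmpty (past _) ()

blockInsertion-nonEmpty : BlockInsertion m d d′ → All (_≢ []) d → All (_≢ []) d′
blockInsertion-nonEmpty (into p) (_ ∷ nes)  = insertion-nonEmpty p ∷ nes
blockInsertion-nonEmpty (past p) (ne ∷ nes) = ne ∷ blockInsertion-nonEmpty p nes

-- Order of the blocks under insertion

minLess-insertˡ⁺ : Insertion m B B′ → B minLess C → B′ minLess C
minLess-insertˡ⁺ p = Any-resp-↭ (↭-sym (insertion-↭ p)) ∘ there

-- The witness in `B′` cannot be `m`: it would lie below an element of `C`, but `C` is non-empty and
-- all its elements are smaller than `m`.
minLess-insertˡ⁻ : Insertion m B B′ → C ≢ [] → All (_< m) C → B′ minLess C → B minLess C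
minLess-insertˡ⁻ p ne C<m q with Any-resp-↭ (insertion-↭ p) q
minLess-insertˡ⁻ p ne []        _ | here _          = contradiction refl ne
minLess-insertˡ⁻ p ne (j<m ∷ _) _ | here (m<j ∷ _) = contradiction m<j (<-asym j<m)
... | there q′ = q′

minLess-insertʳ⁺ : Insertion m C C′ → All (_< m) B → B minLess C → B minLess C′
minLess-insertʳ⁺ p (i<m ∷ _) (here i<C) = here (All-resp-↭ (↭-sym (insertion-↭ p)) (i<m ∷ i<C))
minLess-insertʳ⁺ p (_ ∷ B<m) (there q)  = there (minLess-insertʳ⁺ p B<m q)

minLess-insertʳ⁻ : Insertion m C C′ → B minLess C′ → B minLess C
minLess-insertʳ⁻ p = Any.map (All.tail ∘ All-resp-↭ (insertion-↭ p))

canonical-insert⁺ : BlockInsertion m d d′ → Below m d →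
                    AllPairs _minLess_ d → AllPairs _minLess_ d′
canonical-insert⁺ (into p) _ (h ∷ t) = All.map (minLess-insertˡ⁺ p) h ∷ t
canonical-insert⁺ {m} (past p) (B<m ∷ d<m) (h ∷ t) = first p h ∷ canonical-insert⁺ p d<m t
  where
  first : BlockInsertion m d d′ → All (_ minLess_) d → All (_ minLess_) d′
  first (into q) (h ∷ t) = minLess-insertʳ⁺ q B<m h ∷ t
  first (past q) (h ∷ t) = h ∷ first q t

canonical-insert⁻ : BlockInsertion m d d′ → All (_≢ []) d → Below m d →
                    AllPairs _minLess_ d′ → AllPairs _minLess_ d
canonical-insert⁻ (into p) (_ ∷ nes) (_ ∷ d<m) (h ∷ t) =
  All.zipWith (λ (ne , C<m , q) → minLess-insertˡ⁻ p ne C<m q) (nes , All.zip (d<m , h)) ∷ t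
canonical-insert⁻ {m} (past p) (_ ∷ nes) (_ ∷ d<m) (h ∷ t) =
  first p h ∷ canonical-insert⁻ p nes d<m t
  where
  first : BlockInsertion m d d′ → All (B minLess_) d′ → All (B minLess_) d
  first (into q) (h ∷ t) = minLess-insertʳ⁻ q h ∷ t
  first (past q) (h ∷ t) = h ∷ first q t

-- Separation of the elements of [r] under insertion

NotBoth≤ : ℕ → ℕ → ℕ → Set
NotBoth≤ r i j = ¬ (i ≤ r × j ≤ r)

-- `NotBoth≤ r` is symmetric, so the order of the entries within a block does not matter.
notBoth-resp-↭ : B ↭ B′ → AllPairs (NotBoth≤ r) B → AllPairs (NotBoth≤ r) B′
notBoth-resp-↭ {r = r} p = ↭ₛ.AllPairs-resp-↭ (≡-setoid ℕ) (λ ¬ij (j≤r , i≤r) → ¬ij (i≤r , j≤r))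
  (resp₂ (NotBoth≤ r)) (↭⇒↭ₛ p)

separates-insert⁺ : r < m → BlockInsertion m d d′ → Separates r d → Separates r d′
separates-insert⁺ r<m (into p) (h ∷ t) =
  notBoth-resp-↭ (↭-sym (insertion-↭ p)) (All.universal (λ _ (m≤r , _) → <⇒≱ r<m m≤r) _ ∷ h) ∷ t
separates-insert⁺ r<m (past p) (h ∷ t) = h ∷ separates-insert⁺ r<m p t

separates-insert⁻ : BlockInsertion m d d′ → Separates r d′ → Separates r d
separates-insert⁻ (into p) (h ∷ t) = AllPairs.tail (notBoth-resp-↭ (insertion-↭ p) h) ∷ t
separates-insert⁻ (past p) (h ∷ t) = h ∷ separates-insert⁻ p t

partition⇒below : concat d ↭ [1⋯ N ] → Below (suc N) d
partition⇒below {N = N} p = All.concat⁻ (All-resp-↭ (↭-sym p) (All.map s≤s ([1⋯]-bound N)))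

-- IsRLah with the sizes n + r and k + r decoupled from r.
RLah : (N ℓ r : ℕ) → List Block → Set
RLah N ℓ r d = IsLahDistribution N ℓ d × Separates r d

rLah⇒below : RLah N ℓ r d → Below (suc N) d
rLah⇒below (L , _) = partition⇒below (IsLahDistribution.partition L)

rLah-insert⁺ : r ≤ N → BlockInsertion (suc N) d d′ → RLah N ℓ r d → RLah (suc N) ℓ r d′
rLah-insert⁺ {N = N} r≤N p L@(isLah c e pt o , s) =
  isLah (trans (blockInsertion-length p) c)
        (blockInsertion-nonEmpty p e)
        (↭-trans (blockInsertion-↭ p) (↭-trans (prep (suc N) pt) (↭-sym ([1⋯]-∷ʳ N))))
        (canonical-insert⁺ p (rLah⇒below L) o)
  , separates-insert⁺ (s≤s r≤N) p s

-- Non-emptiness of `d` is a hypothesis because the new element may form a block on its own;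
-- deleting it then leaves an empty block. The partition of the smaller set comes from cancelling
-- `suc N` on both sides.
rLah-insert⁻ : BlockInsertion (suc N) d d′ → All (_≢ []) d → RLah (suc N) ℓ r d′ → RLah N ℓ r d
rLah-insert⁻ {N = N} p ne (isLah c e pt o , s) =
  isLah (trans (sym (blockInsertion-length p)) c) ne pt′
        (canonical-insert⁻ p ne (partition⇒below pt′) o)
  , separates-insert⁻ p s
  where pt′ = drop-∷ (↭-trans (↭-sym (blockInsertion-↭ p)) (↭-trans pt ([1⋯]-∷ʳ N)))

concat-∷ʳ-↭ : ∀ d → concat (d ∷ʳ [ m ]) ↭ m ∷ concat d
concat-∷ʳ-↭ {m} d = ↭-trans (↭-reflexive (sym (concat-++ d [ [ m ] ]))) (++-comm (concat d) [ m ])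

-- The new block has the largest minimum, so canonical order puts it last; a one-element block
-- contains no pair that could violate separation.
rLah-snoc⁺ : RLah N ℓ r d → RLah (suc N) (suc ℓ) r (d ∷ʳ [ suc N ])
rLah-snoc⁺ {N = N} {d = d} L@(isLah c e pt o , s) =
  isLah (trans (length-++-comm d [ [ suc N ] ]) (cong suc c))
        (All.∷ʳ⁺ e λ ())
        (↭-trans (concat-∷ʳ-↭ d) (↭-trans (prep (suc N) pt) (↭-sym ([1⋯]-∷ʳ N))))
        (AllPairs.++⁺ o ([] ∷ []) (All.zipWith (λ (ne , B<) → below ne B< ∷ []) (e , rLah⇒below L)))
  , All.∷ʳ⁺ s ([] ∷ [])
  where
  below : B ≢ [] → All (_< suc N) B → B minLess [ suc N ]
  below ne []      = contradiction refl ne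
  below ne (i< ∷ _) = here (i< ∷ [])

allPairs-++⁻ˡ : ∀ {A : Set} {R : A → A → Set} xs {ys} → AllPairs R (xs ++ ys) → AllPairs R xs
allPairs-++⁻ˡ []       _       = []
allPairs-++⁻ˡ (_ ∷ xs) (h ∷ t) = All.++⁻ˡ xs h ∷ allPairs-++⁻ˡ xs t

rLah-snoc⁻ : ∀ d → RLah (suc N) ℓ r (d ∷ʳ [ suc N ]) → RLah N (length d) r d
rLah-snoc⁻ {N} d (isLah c e pt o , s) =
  isLah refl (All.++⁻ˡ d e)
        (drop-∷ (↭-trans (↭-sym (concat-∷ʳ-↭ d)) (↭-trans pt ([1⋯]-∷ʳ N))))
        (allPairs-++⁻ˡ d o)
  , All.++⁻ˡ d s

-- Removal of the largest element

∈⇒insertion : m ∈ B → ∃ λ B₀ → Insertion m B₀ B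
∈⇒insertion (here refl) = _ , front
∈⇒insertion (there q)   = _ , past (proj₂ (∈⇒insertion q))

-- If the block of `m` has other elements, deleting `m` undoes an insertion. If it is `[ m ]`, it
-- must be last: canonical order would require a later block, which is non-empty, to consist of
-- elements above `m`.
maximum-removal : All (_≢ []) d → All (All (_≤ m)) d → AllPairs _minLess_ d → Any (m ∈_) d →
                  (∃ λ d₀ → All (_≢ []) d₀ × BlockInsertion m d₀ d) ⊎ (∃ λ d₀ → d ≡ d₀ ∷ʳ [ m ])
maximum-removal (_ ∷ nes) (_ ∷ ≤ms) (h ∷ _) (here m∈B) with ∈⇒insertion m∈B
... | _ ∷ _ , p = inj₁ (_ , (λ ()) ∷ nes , into p)
maximum-removal (_ ∷ [])       _                    _                     _ | [] , front = inj₂ ([] , refl)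
maximum-removal (_ ∷ ne ∷ nes) (_ ∷ [] ∷ _)         _                     _ | [] , front = contradiction refl ne
maximum-removal (_ ∷ ne ∷ nes) (_ ∷ (j≤m ∷ _) ∷ _) ((here (m<j ∷ _) ∷ _) ∷ _) _ | [] , front =
  contradiction j≤m (<⇒≱ m<j)
maximum-removal (ne ∷ nes) (_ ∷ ≤ms) (_ ∷ o) (there q) with maximum-removal nes ≤ms o q
... | inj₁ (d₀ , nes₀ , p) = inj₁ (_ ∷ d₀ , ne ∷ nes₀ , past p)
... | inj₂ (d₀ , refl)     = inj₂ (_ ∷ d₀ , refl)

rLah-maximum-removal : RLah (suc N) ℓ r d →
  (∃ λ d₀ → All (_≢ []) d₀ × BlockInsertion (suc N) d₀ d) ⊎ (∃ λ d₀ → d ≡ d₀ ∷ʳ [ suc N ])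
rLah-maximum-removal {N = N} {d = d} (isLah c e pt o , s) = maximum-removal e
  (All.map (All.map m<1+n⇒m≤n) (partition⇒below pt)) o
  (∈-concat⁻ d (∈-resp-↭ (↭-sym (↭-trans pt ([1⋯]-∷ʳ N))) (here refl)))

-- Distinctness of the insertions

≢? : ∀ m → Decidable (_≢ m)
≢? m i = ¬? (i ≟ m)

-- A left inverse of the insertions of `m` into smaller elements. Emptied blocks are kept, so a
-- former block `[ m ]` stays visible as `[]`.
erase : ℕ → List Block → List Block
erase m = map (filter (≢? m))

filter-insertion : All (_< m) B → Insertion m B B′ → filter (≢? m) B′ ≡ B
filter-insertion {m} B<m front =
  trans (filter-reject (≢? m) λ m≢m → m≢m refl) (filter-all (≢? m) (All.map <⇒≢ B<m))
filter-insertion {m} (i<m ∷ B<m) (past p) =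
  trans (filter-accept (≢? m) (<⇒≢ i<m)) (cong (_ ∷_) (filter-insertion B<m p))

erase-below : Below m d → erase m d ≡ d
erase-below []              = refl
erase-below {m} (B<m ∷ d<m) = cong₂ _∷_ (filter-all (≢? m) (All.map <⇒≢ B<m)) (erase-below d<m)

erase-insertion : Below m d → BlockInsertion m d d′ → erase m d′ ≡ d
erase-insertion     (B<m ∷ d<m) (into p) = cong₂ _∷_ (filter-insertion B<m p) (erase-below d<m)
erase-insertion {m} (B<m ∷ d<m) (past p) =
  cong₂ _∷_ (filter-all (≢? m) (All.map <⇒≢ B<m)) (erase-insertion d<m p)

erase-snoc : ∀ d → erase m (d ∷ʳ [ m ]) ≡ erase m d ∷ʳ []
erase-snoc {m} d = trans (map-++ _ d [ [ m ] ])
  (cong (erase m d ∷ʳ_) (filter-reject (≢? m) {xs = []} λ m≢m → m≢m refl))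

insertions-unique : All (_< m) B → Unique (insertions m B)
insertions-unique []          = [] ∷ []
insertions-unique (i<m ∷ B<m) =
  All.map⁺ (All.universal (λ _ eq → <⇒≢ i<m (sym (∷-injectiveˡ eq))) _)
  ∷ Unique.map⁺ ∷-injectiveʳ (insertions-unique B<m)

blockInsertions-unique : Below m d → Unique (blockInsertions m d)
blockInsertions-unique [] = []
blockInsertions-unique {m} {B ∷ d} (B<m ∷ d<m) = Unique.++⁺
  (Unique.map⁺ ∷-injectiveˡ (insertions-unique B<m))
  (Unique.map⁺ ∷-injectiveʳ (blockInsertions-unique d<m))
  -- The first block is one longer than `B` in the first list and equal to `B` in the second.
  λ (p , q) → case ∈-map⁻ _ p , ∈-map⁻ _ q of λ where
    ((_ , p′ , refl) , (_ , q′ , eq)) → 1+n≢n (trans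
      (sym (↭-length (insertion-↭ (∈-insertions⁻ B p′)))) (cong length (∷-injectiveˡ eq)))

-- Bounds on the number of blocks

length-filter-≤1 : AllPairs (NotBoth≤ r) B → length (filter (_≤? r) B) ≤ 1
length-filter-≤1 [] = z≤n
length-filter-≤1 {r} {i ∷ B} (h ∷ t) with i ≤? r
... | yes i≤r = ≤-reflexive (cong length (trans (filter-accept (_≤? r) i≤r) (cong (i ∷_)
                  (filter-none (_≤? r) (All.map (λ ¬ij j≤r → ¬ij (i≤r , j≤r)) h)))))
... | no  i≰r = ≤-trans (≤-reflexive (cong length (filter-reject (_≤? r) i≰r))) (length-filter-≤1 t)

separates-bound : Separates r d → length (filter (_≤? r) (concat d)) ≤ length d
separates-bound [] = z≤n
separates-bound {r} {B ∷ d} (h ∷ t) = begin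
  length (filter (_≤? r) (B ++ concat d))
    ≡⟨ cong length (filter-++ (_≤? r) B (concat d)) ⟩
  length (filter (_≤? r) B ++ filter (_≤? r) (concat d))
    ≡⟨ length-++ (filter (_≤? r) B) ⟩
  length (filter (_≤? r) B) +ℕ length (filter (_≤? r) (concat d))
    ≤⟨ +-mono-≤ (length-filter-≤1 h) (separates-bound t) ⟩
  suc (length d) ∎
  where open ≤-Reasoning

-- Induction on `n`: nothing is lost when the set grows beyond `[r]`. The lower bound is all that
-- the pigeonhole argument uses.
filter-[1⋯] : ∀ r n → r ≤ length (filter (_≤? r) [1⋯ n +ℕ r ])
filter-[1⋯] r zero = ≤-reflexive (sym (trans
  (cong length (filter-all (_≤? r) ([1⋯]-bound r))) (length-applyUpTo suc r)))
filter-[1⋯] r (suc n) = begin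
  r
    ≤⟨ filter-[1⋯] r n ⟩
  length (filter (_≤? r) [1⋯ n +ℕ r ])
    ≤⟨ m≤n+m _ _ ⟩
  length (filter (_≤? r) [ suc n +ℕ r ]) +ℕ length (filter (_≤? r) [1⋯ n +ℕ r ])
    ≡⟨ length-++ (filter (_≤? r) [ suc n +ℕ r ]) ⟨
  length (filter (_≤? r) [ suc n +ℕ r ] ++ filter (_≤? r) [1⋯ n +ℕ r ])
    ≡⟨ cong length (filter-++ (_≤? r) [ suc n +ℕ r ] [1⋯ n +ℕ r ]) ⟨
  length (filter (_≤? r) (suc n +ℕ r ∷ [1⋯ n +ℕ r ]))
    ≡⟨ ↭-length (filter-↭ (_≤? r) ([1⋯]-∷ʳ (n +ℕ r))) ⟨
  length (filter (_≤? r) [1⋯ suc n +ℕ r ]) ∎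
  where open ≤-Reasoning

-- Pigeonhole: a block holds at most one of the `r` separated elements. This rules out `k - 1` for
-- `k = 0`.
rLah⇒r≤ℓ : ∀ n → RLah (n +ℕ r) ℓ r d → r ≤ ℓ
rLah⇒r≤ℓ {r} {d = d} n (isLah c e pt o , s) = begin
  r                                   ≤⟨ filter-[1⋯] r n ⟩
  length (filter (_≤? r) [1⋯ n +ℕ r ]) ≡⟨ ↭-length (filter-↭ (_≤? r) pt) ⟨
  length (filter (_≤? r) (concat d))  ≤⟨ separates-bound s ⟩
  length d                            ≡⟨ c ⟩
  _                                   ∎
  where open ≤-Reasoning

nonEmpty⇒length≤ : All (_≢ []) d → length d ≤ length (concat d)
nonEmpty⇒length≤ [] = z≤n
nonEmpty⇒length≤ {[] ∷ d}      (ne ∷ nes) = contradiction refl ne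
nonEmpty⇒length≤ {(i ∷ B) ∷ d} (ne ∷ nes) = s≤s (≤-trans (nonEmpty⇒length≤ nes)
  (≤-trans (m≤n+m _ (length B)) (≤-reflexive (sym (length-++ B)))))

lah-elements : IsLahDistribution N ℓ d → length (concat d) ≡ N
lah-elements {N} L = trans (↭-length (IsLahDistribution.partition L)) (length-applyUpTo suc N)

-- There are more blocks than elements to make them non-empty. The sum over `k` for `n` can
-- therefore stop at `n`.
𝓛-empty : ∀ r n → 𝓛 r n (suc n) ≡ []
𝓛-empty r n with 𝓛 r n (suc n) in eq
... | []    = refl
... | d ∷ _ = contradiction too-short 1+n≰n
  where
  L : IsLahDistribution (n +ℕ r) (suc n +ℕ r) d
  L = proj₁ (to (∈-𝓛 {r} {n} {suc n}) (subst (d ∈_) (sym eq) (here refl)))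
  too-short : suc n +ℕ r ≤ n +ℕ r
  too-short = begin
    suc n +ℕ r         ≡⟨ IsLahDistribution.blockCount L ⟨
    length d          ≤⟨ nonEmpty⇒length≤ (IsLahDistribution.nonEmpty L) ⟩
    length (concat d) ≡⟨ lah-elements L ⟩
    n +ℕ r             ∎
    where open ≤-Reasoning

-- Recursive description of the distributions

-- 𝓛ᵣ(n,k-1), which is empty for k = 0.
𝓛-pred : (r n k : ℕ) → List (List Block)
𝓛-pred r n zero    = []
𝓛-pred r n (suc k) = 𝓛 r n k

𝓛-pred-unique : ∀ r n k → Unique (𝓛-pred r n k)
𝓛-pred-unique r n zero    = []
𝓛-pred-unique r n (suc k) = 𝓛-unique r n k

-- The equation `suc ℓ ≡ k +ℕ r` treats all `k` alike. For `k = 0` it would mean `r - 1` blocks, too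
-- few to separate `r` elements.
∈-𝓛-pred : ∀ {r n d} k → d ∈ 𝓛-pred r n k ⇔ (∃ λ ℓ → suc ℓ ≡ k +ℕ r × RLah (n +ℕ r) ℓ r d)
∈-𝓛-pred zero = mk⇔ (λ ()) λ where
  (ℓ , refl , L) → contradiction (rLah⇒r≤ℓ _ L) 1+n≰n
∈-𝓛-pred {r} {n} (suc k) = mk⇔ (λ d∈ → k +ℕ r , refl , to (∈-𝓛 {r} {n} {k}) d∈) λ where
  (_ , refl , L) → from (∈-𝓛 {r} {n} {k}) L

-- Both sides are free of duplicates, so it suffices to compare members: `split` removes the largest
-- element and `join` puts it back. On the right, `erase` recovers the distribution from which an
-- insertion came.
𝓛-suc : ∀ r n k → let m = suc (n +ℕ r) in
        𝓛 r (suc n) k ↭ concatMap (blockInsertions m) (𝓛 r n k) ++ map (_∷ʳ [ m ]) (𝓛-pred r n k)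
𝓛-suc r n k = unique∧set⇒↭ (𝓛-unique r (suc n) k)
  (Unique.++⁺
    (concatMap-unique (blockInsertions M) (erase M) (𝓛-unique r n k)
      (λ d∈ → blockInsertions-unique (below d∈))
      (λ {d} d∈ d′∈ → erase-insertion (below d∈) (∈-blockInsertions⁻ d d′∈)))
    (Unique.map⁺ (∷ʳ-injectiveˡ _ _) (𝓛-pred-unique r n k))
    disjoint)
  (mk⇔ split join)
  where
  M = suc (n +ℕ r)

  below : ∀ {d} → d ∈ 𝓛 r n k → Below M d
  below d∈ = rLah⇒below (to (∈-𝓛 {r} {n} {k}) d∈)

  disjoint : ∀ {d′} → ¬ (d′ ∈ concatMap (blockInsertions M) (𝓛 r n k)
                         × d′ ∈ map (_∷ʳ [ M ]) (𝓛-pred r n k))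
  disjoint (p , q) with find (∈-concatMap⁻ (blockInsertions M) p) | ∈-map⁻ _ q
  -- Erasing `M` gives `d` for the insertion, but `erase M e` followed by an empty block for the
  -- appended `[ M ]`; no block of `d` is empty.
  ... | d , d∈ , d′∈ | e , _ , refl = All.lookup
    (IsLahDistribution.nonEmpty (proj₁ (to (∈-𝓛 {r} {n} {k}) d∈)))
    (subst ([] ∈_) (trans (sym (erase-snoc e)) (erase-insertion (below d∈) (∈-blockInsertions⁻ d d′∈)))
      (∈-++⁺ʳ (erase M e) (here refl)))
    refl

  split : ∀ {d′} → d′ ∈ 𝓛 r (suc n) k →
          d′ ∈ concatMap (blockInsertions M) (𝓛 r n k) ++ map (_∷ʳ [ M ]) (𝓛-pred r n k)
  split d′∈ with L ← to (∈-𝓛 {r} {suc n} {k}) d′∈ | rLah-maximum-removal (to (∈-𝓛 {r} {suc n} {k}) d′∈)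
  ... | inj₁ (d , ne , p) = ∈-++⁺ˡ (∈-concatMap⁺ (blockInsertions M)
          (Any.map (λ { refl → ∈-blockInsertions⁺ p }) (from (∈-𝓛 {r} {n} {k}) (rLah-insert⁻ p ne L))))
  ... | inj₂ (d , refl) = ∈-++⁺ʳ _ (∈-map⁺ _ (from (∈-𝓛-pred {r} {n} k)
          (length d , trans (sym (length-++-comm d [ [ M ] ])) (IsLahDistribution.blockCount (proj₁ L))
          , rLah-snoc⁻ d L)))

  join : ∀ {d′} → d′ ∈ concatMap (blockInsertions M) (𝓛 r n k) ++ map (_∷ʳ [ M ]) (𝓛-pred r n k) →
         d′ ∈ 𝓛 r (suc n) k
  join q with ∈-++⁻ (concatMap (blockInsertions M) (𝓛 r n k)) q
  ... | inj₁ p with find (∈-concatMap⁻ (blockInsertions M) p)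
  ...   | d , d∈ , d′∈ = from (∈-𝓛 {r} {suc n} {k})
            (rLah-insert⁺ (m≤n+m r n) (∈-blockInsertions⁻ d d′∈) (to (∈-𝓛 {r} {n} {k}) d∈))
  join q | inj₂ p with ∈-map⁻ _ p
  ... | d , d∈ , refl with to (∈-𝓛-pred {r} {n} k) d∈
  ...   | ℓ , eq , L = from (∈-𝓛 {r} {suc n} {k})
            (subst (λ ℓ → RLah M ℓ r (d ∷ʳ [ M ])) eq (rLah-snoc⁺ L))

-- The case n = 0

-- With all elements in `[r]`, any two in one block would violate separation.
singleton-blocks : All (_≢ []) d → All (All (_≤ r)) d → Separates r d → d ≡ map [_] (concat d)
singleton-blocks [] [] [] = refl
singleton-blocks (ne ∷ _) ([] ∷ _) _ = contradiction refl ne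
singleton-blocks (_ ∷ ne) ((_ ∷ []) ∷ ≤r) (_ ∷ s) = cong (_ ∷_) (singleton-blocks ne ≤r s)
singleton-blocks _ ((i≤r ∷ j≤r ∷ _) ∷ _) (((¬ij ∷ _) ∷ _) ∷ _) = contradiction (i≤r , j≤r) ¬ij

-- All blocks are singletons, so only their order is open, and the canonical display makes it
-- increasing.
𝓛-zero : ∀ r → 𝓛 r 0 0 ↭ [ map [_] [1⋯ r ] ]
𝓛-zero r = unique∧set⇒↭ (𝓛-unique r 0 0) ([] ∷ []) (mk⇔
  (λ d∈ → here (only (to (∈-𝓛 {r} {0} {0}) d∈)))
  λ { (here refl) → from (∈-𝓛 {r} {0} {0}) singletons })
  where
  singletons : RLah r r r (map [_] [1⋯ r ])
  singletons = isLah
    (trans (length-map [_] [1⋯ r ]) (length-applyUpTo suc r))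
    (All.map⁺ (All.universal (λ _ ()) _))
    (↭-reflexive (concat-map-[_] [1⋯ r ]))
    (AllPairs.map⁺ (AllPairs.applyUpTo⁺₁ suc r λ i<j _ → here (s<s i<j ∷ [])))
    , All.map⁺ (All.universal (λ _ → [] ∷ []) _)

  increasing : ∀ xs → AllPairs _minLess_ (map [_] xs) → AllPairs _≤_ xs
  increasing xs o = AllPairs.map (λ { (here (i<j ∷ [])) → <⇒≤ i<j }) (AllPairs.map⁻ o)

  only : ∀ {d} → RLah r r r d → d ≡ map [_] [1⋯ r ]
  -- Two sorted lists that are permutations of each other coincide; here these are `concat d` and
  -- `[1⋯ r ]`.
  only {d} (isLah c e pt o , s) = trans d≡ (cong (map [_]) (Pointwise-≡⇒≡
    (↗↭↗⇒≋ ≤-totalOrder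
      (AllPairs⇒Linked (increasing (concat d) (subst (AllPairs _minLess_) d≡ o)))
      (AllPairs⇒Linked (AllPairs.applyUpTo⁺₁ suc r λ i<j _ → s≤s (<⇒≤ i<j)))
      (↭⇒↭ₛ pt))))
    where
    d≡ : d ≡ map [_] (concat d)
    d≡ = singleton-blocks e (All.map (All.map m<1+n⇒m≤n) (partition⇒below pt)) s

-- Record statistics under insertion

count : ∀ {A : Set} {P : Pred A 0ℓ} → Decidable P → List A → ℕ
count P? = length ∘ filter P?

count-++ : ∀ {A : Set} {P : Pred A 0ℓ} (P? : Decidable P) xs ys →
           count P? (xs ++ ys) ≡ count P? xs +ℕ count P? ys
count-++ P? xs ys = trans (cong length (filter-++ P? xs ys)) (length-++ (filter P? xs))

count-map : ∀ {A B : Set} {P : Pred A 0ℓ} {Q : Pred B 0ℓ} (P? : Decidable P) (Q? : Decidable Q)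
            {f : B → A} {xs} → All (λ x → P (f x) ⇔ Q x) xs → count P? (map f xs) ≡ count Q? xs
count-map P? Q? [] = refl
count-map P? Q? {xs = x ∷ xs} (P⇔Q ∷ P⇔Qs) with Q? x
... | yes q = trans (cong length (filter-accept P? (from P⇔Q q))) (cong suc (count-map P? Q? P⇔Qs))
... | no ¬q = trans (cong length (filter-reject P? (¬q ∘ to P⇔Q))) (count-map P? Q? P⇔Qs)

extend : ℕ → Occurrence → Occurrence
extend i (before , j , after) = i ∷ before , j , after

-- How an old element `i` sees the insertion: `m` arrives on its left or on its right.
data OccurrenceInsertion (m : ℕ) : Occurrence → Occurrence → Set where
  before : ∀ {i} → Insertion m B B′ → OccurrenceInsertion m (B , i , C) (B′ , i , C)
  after  : ∀ {i} → Insertion m C C′ → OccurrenceInsertion m (B , i , C) (B , i , C′)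

extend-insertion : ∀ i → OccurrenceInsertion m o o′ → OccurrenceInsertion m (extend i o) (extend i o′)
extend-insertion i (before p) = before (past p)
extend-insertion i (after p)  = after p

-- The occurrence of the inserted `m` itself, read in `B′`.
occurrence : Insertion m B B′ → Occurrence
occurrence {m} {B} front = [] , m , B
occurrence (past {i} p)  = extend i (occurrence p)

-- P does not notice the insertion of m into the block of a smaller element.
Insensitive : ℕ → Pred Occurrence 0ℓ → Set
Insensitive m P = ∀ {o o′} → proj₁ (proj₂ o) < m → OccurrenceInsertion m o o′ → P o′ ⇔ P o

occurrences-below : All (_< m) B → All (λ (_ , i , _) → i < m) (occurrences B)
occurrences-below []          = []
occurrences-below (i<m ∷ B<m) = i<m ∷ All.map⁺ (occurrences-below B<m)

-- Old occurrences keep their status, so the count changes only by the contribution of `m`. Behind a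
-- first entry `i` all prefixes begin with `i`; the induction therefore runs over all `P` and passes
-- to `P ∘ extend i`, which is insensitive again.
count-insertion : ∀ {P} (P? : Decidable P) → Insensitive m P → All (_< m) B →
                  (p : Insertion m B B′) →
                  count P? (occurrences B′) ≡ count P? [ occurrence p ] +ℕ count P? (occurrences B)
count-insertion {m} {B} P? insens B<m front =
  trans (count-++ P? [ [] , m , B ] (map (extend m) (occurrences B)))
    (cong (count P? [ [] , m , B ] +ℕ_)
      (count-map P? P? (All.map (λ i<m → insens i<m (before front)) (occurrences-below B<m))))
count-insertion {m} {i ∷ B} {i ∷ B′} {P} P? insens (i<m ∷ B<m) (past p) = begin
  count P? (([] , i , B′) ∷ map (extend i) (occurrences B′))
    ≡⟨ count-++ P? [ [] , i , B′ ] (map (extend i) (occurrences B′)) ⟩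
  count P? [ [] , i , B′ ] +ℕ count P? (map (extend i) (occurrences B′))
    ≡⟨ cong₂ _+ℕ_ (count-map P? P? {λ _ → [] , i , B′} {[ [] , i , B ]} (insens i<m (after p) ∷ []))
        (trans (shifted (occurrences B′)) (count-insertion (P? ∘ extend i)
          (λ j<m q → insens j<m (extend-insertion i q)) B<m p)) ⟩
  count P? [ [] , i , B ] +ℕ (count (P? ∘ extend i) [ occurrence p ] +ℕ count (P? ∘ extend i) (occurrences B))
    ≡⟨ cong (count P? [ [] , i , B ] +ℕ_) (cong₂ _+ℕ_ (sym (shifted [ occurrence p ])) (sym (shifted (occurrences B)))) ⟩
  count P? [ [] , i , B ] +ℕ (count P? [ extend i (occurrence p) ] +ℕ count P? (map (extend i) (occurrences B)))
    ≡⟨ x∙yz≈y∙xz (count P? [ [] , i , B ]) (count P? [ extend i (occurrence p) ]) _ ⟩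
  count P? [ extend i (occurrence p) ] +ℕ (count P? [ [] , i , B ] +ℕ count P? (map (extend i) (occurrences B)))
    ≡⟨ cong (count P? [ extend i (occurrence p) ] +ℕ_) (count-++ P? [ [] , i , B ] (map (extend i) (occurrences B))) ⟨
  count P? [ extend i (occurrence p) ] +ℕ count P? (occurrences (i ∷ B)) ∎
  where
  open ≡-Reasoning
  open import Algebra.Properties.CommutativeSemigroup +-commutativeSemigroup using (x∙yz≈y∙xz)
  shifted : ∀ os → count P? (map (extend i) os) ≡ count (P? ∘ extend i) os
  shifted os = count-map P? (P? ∘ extend i) (All.universal (λ _ → mk⇔ id id) os)

nonRecordLow? : Decidable (¬_ ∘ RecordLow)
nonRecordLow? = ¬? ∘ recordLow?

innerRecordLow? : Decidable (λ o → RecordLow o × ¬ Smallest o)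
innerRecordLow? o = recordLow? o ×-dec ¬? (smallest? o)

-- Only smaller elements on the left matter, and `m` is larger than `i`.
recordLow-insensitive : ∀ {o o′} → proj₁ (proj₂ o) < m → OccurrenceInsertion m o o′ →
                        RecordLow o′ ⇔ RecordLow o
recordLow-insensitive i<m (after p)  = mk⇔ id id
recordLow-insensitive i<m (before p) = mk⇔
  (λ low q → low (Any-resp-↭ (↭-sym (insertion-↭ p)) (there q)))
  (λ low q → case Any-resp-↭ (insertion-↭ p) q of λ where
    (here m<i) → <-asym m<i i<m
    (there q′) → low q′)

smallest-insensitive : ∀ {o o′} → proj₁ (proj₂ o) < m → OccurrenceInsertion m o o′ →
                       Smallest o′ ⇔ Smallest o
smallest-insensitive i<m (before {B = B} p) = mk⇔
  (λ s → All.++⁺ (All.tail (All-resp-↭ (insertion-↭ p) (All.++⁻ˡ _ s))) (All.++⁻ʳ _ s))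
  (λ s → All.++⁺ (All-resp-↭ (↭-sym (insertion-↭ p)) (<⇒≤ i<m ∷ All.++⁻ˡ B s)) (All.++⁻ʳ B s))
smallest-insensitive i<m (after {B = B} p) = mk⇔
  (λ s → All.++⁺ (All.++⁻ˡ B s) (All.head (All.++⁻ʳ B s) ∷
    All.tail (All-resp-↭ (insertion-↭ p) (All.tail (All.++⁻ʳ B s)))))
  (λ s → All.++⁺ (All.++⁻ˡ B s) (All.head (All.++⁻ʳ B s) ∷
    All-resp-↭ (↭-sym (insertion-↭ p)) (<⇒≤ i<m ∷ All.tail (All.++⁻ʳ B s))))

nonRecordLow-insensitive : Insensitive m (¬_ ∘ RecordLow)
nonRecordLow-insensitive i<m p = mk⇔ (_∘ from low) (_∘ to low)
  where low = recordLow-insensitive i<m p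

innerRecordLow-insensitive : Insensitive m (λ o → RecordLow o × ¬ Smallest o)
innerRecordLow-insensitive i<m p = mk⇔
  (λ (l , ¬s) → to low l , ¬s ∘ from small)
  (λ (l , ¬s) → from low l , ¬s ∘ to small)
  where
  low   = recordLow-insensitive i<m p
  small = smallest-insensitive i<m p

-- Statistics of a single block

count-accept : ∀ {A : Set} {P : Pred A 0ℓ} (P? : Decidable P) {x} → P x → count P? [ x ] ≡ 1
count-accept P? = cong length ∘ filter-accept P?

count-reject : ∀ {A : Set} {P : Pred A 0ℓ} (P? : Decidable P) {x} → ¬ P x → count P? [ x ] ≡ 0
count-reject P? = cong length ∘ filter-reject P?

nrecᴮ rec*ᴮ : Block → ℕ
nrecᴮ B = count nonRecordLow? (occurrences B)
rec*ᴮ B = count innerRecordLow? (occurrences B)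

nrecᴮ-front : ∀ {i} → All (_< m) (i ∷ B) → nrecᴮ (m ∷ i ∷ B) ≡ nrecᴮ (i ∷ B)
nrecᴮ-front {m} {B} {i} <m = trans (count-insertion nonRecordLow? nonRecordLow-insensitive <m front)
  (cong (_+ℕ nrecᴮ (i ∷ B)) (count-reject nonRecordLow? {[] , m , i ∷ B} λ ¬low → ¬low λ ()))

-- With nothing on its left `m` is a record low, and the smaller `i` prevents it from being the
-- minimum.
rec*ᴮ-front : ∀ {i} → All (_< m) (i ∷ B) → rec*ᴮ (m ∷ i ∷ B) ≡ suc (rec*ᴮ (i ∷ B))
rec*ᴮ-front {m} {B} {i} <m@(i<m ∷ _) =
  trans (count-insertion innerRecordLow? innerRecordLow-insensitive <m front)
    (cong (_+ℕ rec*ᴮ (i ∷ B)) (count-accept innerRecordLow? {[] , m , i ∷ B}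
      ((λ ()) , λ { (_ ∷ m≤i ∷ _) → <⇒≱ i<m m≤i })))

inserted-nonRecordLow : ∀ {i} → i < m → (p : Insertion m B B′) → ¬ RecordLow (extend i (occurrence p))
inserted-nonRecordLow i<m p low = low (here (go i<m p))
  where
  -- The middle component of `occurrence p` is `m`, which becomes visible only by induction on the
  -- position.
  go : ∀ {i} → i < m → (p : Insertion m B B′) → i < proj₁ (proj₂ (occurrence p))
  go i<m front    = i<m
  go i<m (past p) = go i<m p

nrecᴮ-past : ∀ {i} → All (_< m) (i ∷ B) → Insertion m B B′ → nrecᴮ (i ∷ B′) ≡ suc (nrecᴮ (i ∷ B))
nrecᴮ-past {B = B} {i = i} <m@(i<m ∷ _) p =
  trans (count-insertion nonRecordLow? nonRecordLow-insensitive <m (past p))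
    (cong (_+ℕ nrecᴮ (i ∷ B)) (count-accept nonRecordLow? (inserted-nonRecordLow i<m p)))

rec*ᴮ-past : ∀ {i} → All (_< m) (i ∷ B) → Insertion m B B′ → rec*ᴮ (i ∷ B′) ≡ rec*ᴮ (i ∷ B)
rec*ᴮ-past {B = B} {i = i} <m@(i<m ∷ _) p =
  trans (count-insertion innerRecordLow? innerRecordLow-insensitive <m (past p))
    (cong (_+ℕ rec*ᴮ (i ∷ B)) (count-reject innerRecordLow? (inserted-nonRecordLow i<m p ∘ proj₁)))

nrecᴮ-singleton : ∀ i → nrecᴮ [ i ] ≡ 0
nrecᴮ-singleton i = count-reject nonRecordLow? {[] , i , []} λ ¬low → ¬low λ ()

rec*ᴮ-singleton : ∀ i → rec*ᴮ [ i ] ≡ 0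
rec*ᴮ-singleton i = count-reject innerRecordLow? {[] , i , []} λ (_ , ¬s) → ¬s (≤-refl ∷ [])

nrec-∷ : ∀ B d → nrec (B ∷ d) ≡ nrecᴮ B +ℕ nrec d
nrec-∷ B d = count-++ nonRecordLow? (occurrences B) (concatMap occurrences d)

rec*-∷ : ∀ B d → rec* (B ∷ d) ≡ rec*ᴮ B +ℕ rec* d
rec*-∷ B d = count-++ innerRecordLow? (occurrences B) (concatMap occurrences d)

-- Weighted sums

module _ {c ℓ} (R : CommutativeRing c ℓ) where
  open CommutativeRing R
    renaming (refl to ≈-refl; trans to ≈-trans; sym to ≈-sym; reflexive to ≈-reflexive)
    hiding (zero)
  open RLahNumbers R
  open SemiringMult semiring using (×-congˡ; ×-homo-+; ×-assoc-*)
  open SemiringExp semiring using (^-homo-*)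
  open CommutativeMonoidMult +-commutativeMonoid using (×-distrib-+)
  open import Relation.Binary.Reasoning.Setoid setoid
  open Solver commutativeSemiring using (solve; _:=_; _:+_; _:*_)

  private variable
    A A′ : Set

  ∑-cong : ∀ {xs : List A} {f g : A → Carrier} → All (λ x → f x ≈ g x) xs → ∑ xs f ≈ ∑ xs g
  ∑-cong []         = ≈-refl
  ∑-cong (eq ∷ eqs) = +-cong eq (∑-cong eqs)

  ∑-cong-≗ : ∀ (xs : List A) {f g : A → Carrier} → (∀ x → f x ≈ g x) → ∑ xs f ≈ ∑ xs g
  ∑-cong-≗ xs f≈g = ∑-cong (All.universal f≈g xs)

  ∑-↭ : ∀ {xs ys : List A} (f : A → Carrier) → xs ↭ ys → ∑ xs f ≈ ∑ ys f
  ∑-↭ f _↭_.refl           = ≈-refl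
  ∑-↭ f (_↭_.prep x p)   = +-congˡ (∑-↭ f p)
  ∑-↭ f (_↭_.swap x y p) = ≈-trans (+-congˡ (+-congˡ (∑-↭ f p)))
    (solve 3 (λ x y s → x :+ (y :+ s) := y :+ (x :+ s)) ≈-refl (f x) (f y) _)
  ∑-↭ f (_↭_.trans p q)  = ≈-trans (∑-↭ f p) (∑-↭ f q)

  ∑-++ : ∀ (xs : List A) {ys} (f : A → Carrier) → ∑ (xs ++ ys) f ≈ ∑ xs f + ∑ ys f
  ∑-++ []       f = ≈-sym (+-identityˡ _)
  ∑-++ (x ∷ xs) f = ≈-trans (+-congˡ (∑-++ xs f)) (≈-sym (+-assoc _ _ _))

  ∑-map : ∀ (g : A′ → A) xs (f : A → Carrier) → ∑ (map g xs) f ≈ ∑ xs (f ∘ g)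
  ∑-map g xs f = ≈-reflexive (cong (foldr _+_ 0#) (sym (map-∘ xs)))

  ∑-concatMap : ∀ (g : A′ → List A) xs (f : A → Carrier) →
                ∑ (concatMap g xs) f ≈ ∑[ x ← xs ] (∑ (g x) f)
  ∑-concatMap g []       f = ≈-refl
  ∑-concatMap g (x ∷ xs) f = ≈-trans (∑-++ (g x) f) (+-congˡ (∑-concatMap g xs f))

  *-∑ : ∀ y (xs : List A) (f : A → Carrier) → ∑[ x ← xs ] (y * f x) ≈ y * ∑ xs f
  *-∑ y []       f = ≈-sym (zeroʳ y)
  *-∑ y (x ∷ xs) f = ≈-trans (+-congˡ (*-∑ y xs f)) (≈-sym (distribˡ y _ _))

  ∑-+ : ∀ (xs : List A) (f g : A → Carrier) → ∑[ x ← xs ] (f x + g x) ≈ ∑ xs f + ∑ xs g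
  ∑-+ []       f g = ≈-sym (+-identityˡ 0#)
  ∑-+ (x ∷ xs) f g = ≈-trans (+-congˡ (∑-+ xs f g))
    (solve 4 (λ a b s t → (a :+ b) :+ (s :+ t) := (a :+ s) :+ (b :+ t)) ≈-refl (f x) (g x) _ _)

  ∑-const : ∀ {xs : List A} {f : A → Carrier} {y} → All (λ x → f x ≈ y) xs → ∑ xs f ≈ length xs · y
  ∑-const []         = ≈-refl
  ∑-const (eq ∷ eqs) = +-cong eq (∑-const eqs)

  ∑-upTo-last : ∀ n (f : ℕ → Carrier) → ∑ (upTo (suc n)) f ≈ ∑ (upTo n) f + f n
  ∑-upTo-last n f = begin
    ∑ (upTo (suc n)) f        ≡⟨ cong (λ is → ∑ is f) (upTo-∷ʳ n) ⟨
    ∑ (upTo n ∷ʳ n) f         ≈⟨ ∑-++ (upTo n) f ⟩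
    ∑ (upTo n) f + (f n + 0#) ≈⟨ +-congˡ (+-identityʳ (f n)) ⟩
    ∑ (upTo n) f + f n        ∎

  ∑-upTo-first : ∀ n (f : ℕ → Carrier) → ∑ (upTo (suc n)) f ≈ f 0 + ∑[ i ← upTo n ] f (suc i)
  ∑-upTo-first n f = +-congˡ (≈-trans
    (≈-reflexive (cong (λ is → ∑ is f) (sym (map-upTo suc n)))) (∑-map suc (upTo n) f))

  ∏-upTo-last : ∀ n (f : ℕ → Carrier) → ∏ (upTo (suc n)) f ≈ ∏ (upTo n) f * f n
  ∏-upTo-last n f = ≈-trans (≈-reflexive (cong (λ is → ∏ is f) (sym (upTo-∷ʳ n)))) (snoc (upTo n))
    where
    snoc : ∀ is → ∏ (is ∷ʳ n) f ≈ ∏ is f * f n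
    snoc []       = *-comm (f n) 1#
    snoc (i ∷ is) = ≈-trans (*-congˡ (snoc is)) (≈-sym (*-assoc _ _ _))

  -- Weights under insertion

  module _ (a b : Carrier) where

    weightᴮ : Block → Carrier
    weightᴮ B = (a ^ nrecᴮ B) * (b ^ rec*ᴮ B)

    weight : List Block → Carrier
    weight d = (a ^ nrec d) * (b ^ rec* d)

    weight-∷ : ∀ B d → weight (B ∷ d) ≈ weightᴮ B * weight d
    weight-∷ B d = begin
      (a ^ nrec (B ∷ d)) * (b ^ rec* (B ∷ d))
        ≡⟨ cong₂ (λ i j → (a ^ i) * (b ^ j)) (nrec-∷ B d) (rec*-∷ B d) ⟩
      (a ^ (nrecᴮ B +ℕ nrec d)) * (b ^ (rec*ᴮ B +ℕ rec* d))
        ≈⟨ *-cong (^-homo-* a (nrecᴮ B) (nrec d)) (^-homo-* b (rec*ᴮ B) (rec* d)) ⟩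
      ((a ^ nrecᴮ B) * (a ^ nrec d)) * ((b ^ rec*ᴮ B) * (b ^ rec* d))
        ≈⟨ solve 4 (λ p q s t → (p :* q) :* (s :* t) := (p :* s) :* (q :* t)) ≈-refl _ _ _ _ ⟩
      weightᴮ B * weight d ∎

    weightᴮ-front : ∀ {i} → All (_< m) (i ∷ B) → weightᴮ (m ∷ i ∷ B) ≈ b * weightᴮ (i ∷ B)
    weightᴮ-front <m = ≈-trans
      (≈-reflexive (cong₂ (λ i j → (a ^ i) * (b ^ j)) (nrecᴮ-front <m) (rec*ᴮ-front <m)))
      (solve 3 (λ p b q → p :* (b :* q) := b :* (p :* q)) ≈-refl _ b _)

    weightᴮ-past : ∀ {i} → All (_< m) (i ∷ B) → Insertion m B B′ →
                   weightᴮ (i ∷ B′) ≈ a * weightᴮ (i ∷ B)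
    weightᴮ-past <m p = ≈-trans
      (≈-reflexive (cong₂ (λ i j → (a ^ i) * (b ^ j)) (nrecᴮ-past <m p) (rec*ᴮ-past <m p)))
      (*-assoc a _ _)

    weightᴮ-singleton : ∀ i → weightᴮ [ i ] ≈ 1#
    weightᴮ-singleton i = ≈-trans
      (≈-reflexive (cong₂ (λ i j → (a ^ i) * (b ^ j)) (nrecᴮ-singleton i) (rec*ᴮ-singleton i)))
      (*-identityˡ 1#)

    weight-singletons : ∀ is → weight (map [_] is) ≈ 1#
    weight-singletons []       = *-identityˡ 1#
    weight-singletons (i ∷ is) = ≈-trans (weight-∷ [ i ] (map [_] is))
      (≈-trans (*-cong (weightᴮ-singleton i) (weight-singletons is)) (*-identityˡ 1#))

    weight-snoc : ∀ d i → weight (d ∷ʳ [ i ]) ≈ weight d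
    weight-snoc []      i = ≈-trans (weight-singletons [ i ]) (≈-sym (weight-singletons []))
    weight-snoc (B ∷ d) i = begin
      weight (B ∷ d ∷ʳ [ i ])         ≈⟨ weight-∷ B (d ∷ʳ [ i ]) ⟩
      weightᴮ B * weight (d ∷ʳ [ i ]) ≈⟨ *-congˡ (weight-snoc d i) ⟩
      weightᴮ B * weight d            ≈⟨ weight-∷ B d ⟨
      weight (B ∷ d)                  ∎

    -- The front contributes a factor `b`, each position behind an element a factor `a`. An empty
    -- block would break the count: there `m` becomes the minimum and the factor is one.
    ∑-insertions : B ≢ [] → All (_< m) B →
                   ∑ (insertions m B) weightᴮ ≈ (length B · a + b) * weightᴮ B
    ∑-insertions {[]}        ne _  = contradiction refl ne
    ∑-insertions {i ∷ B} {m} _  <m = begin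
      weightᴮ (m ∷ i ∷ B) + ∑ (map (i ∷_) (insertions m B)) weightᴮ
        ≈⟨ +-cong (weightᴮ-front <m) (∑-const (All.map⁺ (All.tabulate λ B′∈ →
             weightᴮ-past <m (∈-insertions⁻ B B′∈)))) ⟩
      b * w + length (map (i ∷_) (insertions m B)) · (a * w)
        -- The tail `B` offers one position more than it has entries, hence `length (i ∷ B)`
        -- positions behind `i`.
        ≈⟨ +-congˡ (×-congˡ (trans (length-map (i ∷_) (insertions m B)) (length-insertions m B))) ⟩
      b * w + length (i ∷ B) · (a * w)
        ≈⟨ +-congˡ (×-assoc-* (length (i ∷ B)) a w) ⟨
      b * w + (length (i ∷ B) · a) * w
        ≈⟨ solve 3 (λ b A w → b :* w :+ A :* w := (A :+ b) :* w) ≈-refl b _ w ⟩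
      (length (i ∷ B) · a + b) * w ∎
      where w = weightᴮ (i ∷ B)

    -- The weight is multiplicative over blocks and an insertion changes one block only, so the
    -- factors of the individual blocks add up.
    ∑-blockInsertions : All (_≢ []) d → Below m d →
      ∑ (blockInsertions m d) weight ≈ (length (concat d) · a + length d · b) * weight d
    ∑-blockInsertions [] [] = ≈-sym (≈-trans (*-congʳ (+-identityˡ 0#)) (zeroˡ _))
    ∑-blockInsertions {B ∷ d} {m} (ne ∷ nes) (B<m ∷ d<m) = begin
      ∑ (map (_∷ d) (insertions m B) ++ map (B ∷_) (blockInsertions m d)) weight
        ≈⟨ ∑-++ (map (_∷ d) (insertions m B)) weight ⟩
      ∑ (map (_∷ d) (insertions m B)) weight + ∑ (map (B ∷_) (blockInsertions m d)) weight
        ≈⟨ +-cong (≈-trans (∑-map (_∷ d) (insertions m B) weight)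
                    (∑-cong-≗ (insertions m B) λ B′ → ≈-trans (weight-∷ B′ d) (*-comm _ _)))
                  (≈-trans (∑-map (B ∷_) (blockInsertions m d) weight)
                    (∑-cong-≗ (blockInsertions m d) (weight-∷ B))) ⟩
      ∑[ B′ ← insertions m B ] (weight d * weightᴮ B′) + ∑[ d′ ← blockInsertions m d ] (weightᴮ B * weight d′)
        ≈⟨ +-cong (*-∑ (weight d) (insertions m B) weightᴮ) (*-∑ (weightᴮ B) (blockInsertions m d) weight) ⟩
      weight d * ∑ (insertions m B) weightᴮ + weightᴮ B * ∑ (blockInsertions m d) weight
        ≈⟨ +-cong (*-congˡ (∑-insertions ne B<m)) (*-congˡ (∑-blockInsertions nes d<m)) ⟩
      weight d * ((length B · a + b) * weightᴮ B)
        + weightᴮ B * ((length (concat d) · a + length d · b) * weight d)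
        ≈⟨ solve 6 (λ w v p q s t → w :* ((p :+ q) :* v) :+ v :* ((s :+ t) :* w)
                                 := ((p :+ s) :+ (q :+ t)) :* (v :* w))
             ≈-refl (weight d) (weightᴮ B) (length B · a) b (length (concat d) · a) (length d · b) ⟩
      ((length B · a + length (concat d) · a) + (b + length d · b)) * (weightᴮ B * weight d)
        ≈⟨ *-cong (+-congʳ (≈-trans (≈-sym (×-homo-+ a (length B) (length (concat d))))
                    (×-congˡ (sym (length-++ B))))) (≈-sym (weight-∷ B d)) ⟩
      (length (concat (B ∷ d)) · a + length (B ∷ d) · b) * weight (B ∷ d) ∎

    -- The recursion for the generalized r-Lah numbers

    𝓖-pred : (n k r : ℕ) → Carrier
    𝓖-pred n k r = ∑ (𝓛-pred r n k) weight

    -- Every member of `𝓛 r n k` has `n +ℕ r` elements and `k +ℕ r` blocks, so the insertion factor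
    -- is the same for all and leaves the sum. An appended singleton has weight one.
    𝓖-suc : ∀ n k r →
            𝓖 a b (suc n) k r ≈ ((n +ℕ r) · a + (k +ℕ r) · b) * 𝓖 a b n k r + 𝓖-pred n k r
    𝓖-suc n k r = begin
      ∑ (𝓛 r (suc n) k) weight
        ≈⟨ ∑-↭ weight (𝓛-suc r n k) ⟩
      ∑ (concatMap (blockInsertions M) (𝓛 r n k) ++ map (_∷ʳ [ M ]) (𝓛-pred r n k)) weight
        ≈⟨ ∑-++ (concatMap (blockInsertions M) (𝓛 r n k)) weight ⟩
      ∑ (concatMap (blockInsertions M) (𝓛 r n k)) weight + ∑ (map (_∷ʳ [ M ]) (𝓛-pred r n k)) weight
        ≈⟨ +-cong (∑-concatMap (blockInsertions M) (𝓛 r n k) weight)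
                  (≈-trans (∑-map (_∷ʳ [ M ]) (𝓛-pred r n k) weight)
                    (∑-cong-≗ (𝓛-pred r n k) λ d → weight-snoc d M)) ⟩
      ∑[ d ← 𝓛 r n k ] (∑ (blockInsertions M d) weight) + 𝓖-pred n k r
        ≈⟨ +-congʳ (≈-trans (∑-cong (All.tabulate (λ d∈ → each (to (∈-𝓛 {r} {n} {k}) d∈)))) (*-∑ _ (𝓛 r n k) weight)) ⟩
      ((n +ℕ r) · a + (k +ℕ r) · b) * 𝓖 a b n k r + 𝓖-pred n k r ∎
      where
      M = suc (n +ℕ r)
      each : ∀ {d} → RLah (n +ℕ r) (k +ℕ r) r d →
             ∑ (blockInsertions M d) weight ≈ ((n +ℕ r) · a + (k +ℕ r) · b) * weight d
      each L@(lah , _) = ≈-trans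
        (∑-blockInsertions (IsLahDistribution.nonEmpty lah) (rLah⇒below L))
        (*-congʳ (+-cong (×-congˡ (lah-elements lah)) (×-congˡ (IsLahDistribution.blockCount lah))))

    𝓖-zero : ∀ r → 𝓖 a b 0 0 r ≈ 1#
    𝓖-zero r = ≈-trans (∑-↭ weight (𝓛-zero r)) (≈-trans (+-identityʳ _) (weight-singletons [1⋯ r ]))

    𝓖-empty : ∀ n r → 𝓖 a b n (suc n) r ≈ 0#
    𝓖-empty n r = ≈-reflexive (cong (λ ds → ∑ ds weight) (𝓛-empty r n))

    -- Expansion in falling factorials

    module _ (x : Carrier) where

      -- The falling factorial of `x` with step `b`.
      falling : ℕ → Carrier
      falling k = ∏[ i ← upTo k ] (x - i · b)

      -- The multiples of `b` depending on `k` cancel; being free of `k`, the result can be taken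
      -- out of the sum over `k`.
      factor-split : ∀ n k r → ((n +ℕ r) · a + (k +ℕ r) · b) + (x - k · b) ≈ x + r · (a + b) + n · a
      factor-split n k r = begin
        ((n +ℕ r) · a + (k +ℕ r) · b) + (x - k · b)
          ≈⟨ +-congʳ (+-cong (×-homo-+ a n r) (×-homo-+ b k r)) ⟩
        ((n · a + r · a) + (k · b + r · b)) + (x - k · b)
          -- The negative `- (k · b)` enters as an indeterminate of its own and is cancelled against
          -- `k · b` in the following step.
          ≈⟨ solve 6 (λ na ra kb rb x -kb → ((na :+ ra) :+ (kb :+ rb)) :+ (x :+ -kb)
                                         := (x :+ (ra :+ rb) :+ na) :+ (kb :+ -kb))
               ≈-refl (n · a) (r · a) (k · b) (r · b) x (- (k · b)) ⟩
        (x + (r · a + r · b) + n · a) + (k · b - k · b)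
          ≈⟨ +-cong (+-congʳ (+-congˡ (≈-sym (×-distrib-+ a b r)))) (-‿inverseʳ (k · b)) ⟩
        (x + r · (a + b) + n · a) + 0#
          ≈⟨ +-identityʳ _ ⟩
        x + r · (a + b) + n · a ∎

      ∑-𝓖-suc : ∀ n r → ∑[ k ← upTo (suc (suc n)) ] (𝓖 a b (suc n) k r * falling k)
                          ≈ (x + r · (a + b) + n · a) * ∑[ k ← upTo (suc n) ] (𝓖 a b n k r * falling k)
      ∑-𝓖-suc n r = begin
        ∑[ k ← upTo (suc (suc n)) ] (𝓖 a b (suc n) k r * falling k)
          ≈⟨ ∑-cong-≗ (upTo (suc (suc n))) (λ k → ≈-trans (*-congʳ (𝓖-suc n k r)) (distribʳ _ _ _)) ⟩
        ∑[ k ← upTo (suc (suc n)) ] (kept k + new k)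
          ≈⟨ ∑-+ (upTo (suc (suc n))) kept new ⟩
        ∑ (upTo (suc (suc n))) kept + ∑ (upTo (suc (suc n))) new
          -- The two sums lose opposite ends: `kept (suc n)` vanishes by `𝓖-empty`, and `new 0`
          -- because `𝓛-pred` is empty there. After the index shift both run over `0, …, n`.
          ≈⟨ +-cong (∑-upTo-last (suc n) kept) (∑-upTo-first (suc n) new) ⟩
        (∑ (upTo (suc n)) kept + kept (suc n)) + (new 0 + ∑[ k ← upTo (suc n) ] new (suc k))
          ≈⟨ +-cong (≈-trans (+-congˡ kept-last) (+-identityʳ _))
                    (≈-trans (+-congʳ (zeroˡ _)) (+-identityˡ _)) ⟩
        ∑ (upTo (suc n)) kept + ∑[ k ← upTo (suc n) ] new (suc k)
          ≈⟨ ∑-+ (upTo (suc n)) kept (new ∘ suc) ⟨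
        ∑[ k ← upTo (suc n) ] (kept k + new (suc k))
          ≈⟨ ∑-cong-≗ (upTo (suc n)) combine ⟩
        ∑[ k ← upTo (suc n) ] ((x + r · (a + b) + n · a) * (𝓖 a b n k r * falling k))
          ≈⟨ *-∑ _ (upTo (suc n)) _ ⟩
        (x + r · (a + b) + n · a) * ∑[ k ← upTo (suc n) ] (𝓖 a b n k r * falling k) ∎
        where
        kept new : ℕ → Carrier
        kept k = (((n +ℕ r) · a + (k +ℕ r) · b) * 𝓖 a b n k r) * falling k
        new k  = 𝓖-pred n k r * falling k

        kept-last : kept (suc n) ≈ 0#
        kept-last = ≈-trans (*-congʳ (≈-trans (*-congˡ (𝓖-empty n r)) (zeroʳ _))) (zeroˡ _)

        combine : ∀ k → kept k + new (suc k) ≈ (x + r · (a + b) + n · a) * (𝓖 a b n k r * falling k)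
        combine k = begin
          kept k + 𝓖 a b n k r * falling (suc k)
            -- The shifted term carries one more factor `x - k · b`, which joins the insertion
            -- factor of `kept k`.
            ≈⟨ +-congˡ (*-congˡ (∏-upTo-last k (λ i → x - i · b))) ⟩
          kept k + 𝓖 a b n k r * (falling k * (x - k · b))
            ≈⟨ solve 4 (λ c g p q → (c :* g) :* p :+ g :* (p :* q) := (c :+ q) :* (g :* p)) ≈-refl
                 ((n +ℕ r) · a + (k +ℕ r) · b) (𝓖 a b n k r) (falling k) (x - k · b) ⟩
          (((n +ℕ r) · a + (k +ℕ r) · b) + (x - k · b)) * (𝓖 a b n k r * falling k)
            ≈⟨ *-congʳ (factor-split n k r) ⟩
          (x + r · (a + b) + n · a) * (𝓖 a b n k r * falling k) ∎

      rising-factorial-expansion : ∀ r n → ∏[ i ← upTo n ] (x + r · (a + b) + i · a)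
                                             ≈ ∑[ k ← upTo (suc n) ] (𝓖 a b n k r * falling k)
      rising-factorial-expansion r zero =
        -- Only `k = 0` occurs, with an empty product as falling factorial.
        ≈-sym (≈-trans (+-identityʳ _) (≈-trans (*-identityʳ _) (𝓖-zero r)))
      rising-factorial-expansion r (suc n) = begin
        ∏[ i ← upTo (suc n) ] factor i
          ≈⟨ ∏-upTo-last n factor ⟩
        ∏ (upTo n) factor * factor n
          ≈⟨ *-comm _ _ ⟩
        factor n * ∏ (upTo n) factor
          ≈⟨ *-congˡ (rising-factorial-expansion r n) ⟩
        factor n * ∑[ k ← upTo (suc n) ] (𝓖 a b n k r * falling k)
          ≈⟨ ∑-𝓖-suc n r ⟨
        ∑[ k ← upTo (suc (suc n)) ] (𝓖 a b (suc n) k r * falling k) ∎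
        where
        factor : ℕ → Carrier
        factor i = x + r · (a + b) + i · a

theorem2p2 : ∀ {c ℓ} (R : CommutativeRing c ℓ) →
    let open CommutativeRing R
        open RLahNumbers R
    in (a b x : Carrier) (r n : ℕ) →
       ∏[ i ← upTo n ] (x + r · (a + b) + i · a)
         ≈ ∑[ k ← upTo (suc n) ] (𝓖 a b n k r * ∏[ i ← upTo k ] (x - i · b))
theorem2p2 R a b x r n = rising-factorial-expansion R a b x r n
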